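{- Let $\mathcal{P}$ be a vine. The following are equivalent: (1) $\mathcal{P}$ is an m-vine, i.e. there exists an R-vine $\mathcal{R}$ such that $\mathcal{P}$ is an ideal (downward-closed subset) of $\mathcal{R}$; (2) $\mathcal{P}$ satisfies the proximity condition: for any distinct elements $a,b$ of the same rank $i\ge2$, if $a$ and $b$ are covered by a common element, then $a$ and $b$ cover a common element; (3) $\mathcal{P}$ is an LR-vine.
   Context: Posets are finite. A poset $\mathcal{P}$ is graded with rank function $\operatorname{rk}\colon\mathcal{P}\to\mathbb{Z}_{>0}$ if $x<y$ implies $\operatorname{rk}(x)<\operatorname{rk}(y)$, $\operatorname{rk}(y)=\operatorname{rk}(x)+1$ whenever $y$ covers $x$, and all minimal elements have rank $1$. $\mathcal{P}_i$ denotes the set of elements of rank $i$, $\operatorname{rk}(\mathcal{P})$ the maximal rank, $\dim(\mathcal{P})$ the number of minimal elements, and $\mathcal{E}(v)$ the set of elements covered by $v$. A vine is a finite graded poset such that (1) every non-minimal element covers exactly two elements, and any two distinct elements of the same rank are covered by at most one common element; (2) for each $1\le i\le\operatorname{rk}(\mathcal{P})$ the graph $F_i$ with vertex set $\mathcal{P}_i$ and edge set $\{\mathcal{E}(v)\mid v\in\mathcal{P}_{i+1}\}$ is a forest. An R-vine is a vine with $\operatorname{rk}(\mathcal{P})=\dim(\mathcal{P})$, every $F_i$ a tree, and satisfying the proximity condition. An LR-vine is a vine such that every principal ideal $\mathcal{P}_{\le v}=\{x\in\mathcal{P}\mid x\le v\}$, with the induced order and rank, is an R-vine. An ideal of a vine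 is regarded with the induced order and rank function. -}

module Defs where

open import Level using (Level) renaming (suc to lsuc; zero to lzero)
open import Data.Nat using (ℕ; zero; suc; _≤_; _<_; _⊔_)
open import Data.Fin using (Fin; inject₁; fromℕ) renaming (zero to fzero; suc to fsuc)
open import Data.List using (foldr)
open import Data.List using () renaming (map to lmap)
open import Data.Fin using ()
open import Data.Product using (Σ; ∃; ∃-syntax; _×_; _,_)
open import Data.Sum using (_⊎_)
open import Relation.Nullary using (¬_)
open import Data.Empty using (⊥)
open import Relation.Binary.PropositionalEquality using (_≡_; _≢_)
open import Function.Definitions using (Injective)
open import Function.Bundles using (_⇔_)
import Data.Vec.Functional as VF

record GradedPoset : Set₁ where
  field
    n      : ℕ
    _≼_    : Fin n → Fin n → Set
    ≼-refl  : ∀ x → x ≼ x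
    ≼-antisym : ∀ {x y} → x ≼ y → y ≼ x → x ≡ y
    ≼-trans : ∀ {x y z} → x ≼ y → y ≼ z → x ≼ z
    rk     : Fin n → ℕ

  _≺_ : Fin n → Fin n → Set
  x ≺ y = x ≼ y × x ≢ y

  _⋖_ : Fin n → Fin n → Set
  x ⋖ y = x ≺ y × (∀ z → x ≺ z → z ≺ y → ⊥)

  IsMinimal : Fin n → Set
  IsMinimal x = ∀ y → y ≼ x → y ≡ x

  field
    rk-pos    : ∀ x → 1 ≤ rk x
    rk-strict : ∀ {x y} → x ≺ y → rk x < rk y
    rk-cover  : ∀ {x y} → x ⋖ y → rk y ≡ suc (rk x)
    rk-min    : ∀ x → IsMinimal x → rk x ≡ 1

open GradedPoset public

HasCard : {m : ℕ} → (Fin m → Set) → ℕ → Set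
HasCard {m} Q k =
  Σ (Fin k → Fin m) λ e →
    Injective _≡_ _≡_ e × (∀ j → Q (e j)) × (∀ x → Q x → ∃[ j ] e j ≡ x)

module _ (P : GradedPoset) where
  private
    N = n P
    X = Fin N

  maxRank : ℕ
  maxRank = VF.foldr (λ x m → rk P x ⊔ m) 0 (λ x → x)

  Dim : ℕ → Set
  Dim k = HasCard (IsMinimal P) k

  CoverPair : X → X → X → Set
  CoverPair v a b =
    a ≢ b × _⋖_ P a v × _⋖_ P b v × (∀ c → _⋖_ P c v → c ≡ a ⊎ c ≡ b)

  -- F_i : vertices P_i, edges E(v) for v ∈ P_{i+1}
  FEdge : ℕ → X → X → X → Set
  FEdge i v a b = rk P v ≡ suc i × rk P a ≡ i × rk P b ≡ i × CoverPair v a b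

  record Cycle (i : ℕ) : Set where
    field
      k     : ℕ
      k≥1   : 1 ≤ k
      xs    : Fin (suc k) → X
      xs-inj : Injective _≡_ _≡_ xs
      es    : Fin k → X
      es-inj : Injective _≡_ _≡_ es
      eLast : X
      eLast-new : ∀ j → es j ≢ eLast
      es-edge : ∀ j → FEdge i (es j) (xs (inject₁ j)) (xs (fsuc j))
      eLast-edge : FEdge i eLast (xs (fromℕ k)) (xs fzero)

  IsForest : ℕ → Set
  IsForest i = ¬ Cycle i

  data Walk (i : ℕ) : X → X → Set where
    here : ∀ {x} → Walk i x x
    step : ∀ {x y z} v → FEdge i v x y → Walk i y z → Walk i x z

  IsTree : ℕ → Set
  IsTree i = IsForest i × (∀ x y → rk P x ≡ i → rk P y ≡ i → Walk i x y)

  IsVine : Set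
  IsVine =
    (∀ v → ¬ IsMinimal P v → ∃[ a ] ∃[ b ] CoverPair v a b)
    × (∀ a b u w → a ≢ b → rk P a ≡ rk P b →
         _⋖_ P a u → _⋖_ P b u → _⋖_ P a w → _⋖_ P b w → u ≡ w)
    × (∀ i → 1 ≤ i → i ≤ maxRank → IsForest i)

  Proximity : Set
  Proximity =
    ∀ a b → a ≢ b → rk P a ≡ rk P b → 2 ≤ rk P a →
      (∃[ v ] (_⋖_ P a v × _⋖_ P b v)) →
      ∃[ c ] (_⋖_ P c a × _⋖_ P c b)

  IsRVine : Set
  IsRVine =
    IsVine × Dim maxRank × (∀ i → 1 ≤ i → i ≤ maxRank → IsTree i) × Proximity

IsIdealEmbedding : (Q P : GradedPoset) → (Fin (n Q) → Fin (n P)) → Set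
IsIdealEmbedding Q P f =
  Injective _≡_ _≡_ f
  × (∀ x y → (_≼_ Q x y → _≼_ P (f x) (f y)) × (_≼_ P (f x) (f y) → _≼_ Q x y))
  × (∀ x → rk P (f x) ≡ rk Q x)
  × (∀ x z → _≼_ P z (f x) → ∃[ y ] f y ≡ z)

IsIdealOf : GradedPoset → GradedPoset → Set
IsIdealOf P R = ∃[ f ] IsIdealEmbedding P R f

IsMVine : GradedPoset → Set₁
IsMVine P = ∃[ R ] (IsRVine R × IsIdealOf P R)

-- LR-vine: every principal ideal P_{≤ v} (realised as a graded poset Q
-- embedded as an ideal of P with image exactly {x | x ≤ v}) is an R-vine
IsLRVine : GradedPoset → Set₁
IsLRVine P =
  ∀ v → ∃[ Q ] ∃[ f ] (IsIdealEmbedding Q P f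
          × (∀ x → _≼_ P x v → ∃[ y ] f y ≡ x)
          × (∀ y → _≼_ P (f y) v)
          × IsRVine Q)

module Submission where

-- Let F be the disjoint union of the forests F_i: its vertices are all elements, and every
-- non-minimal v is an edge joining the two elements it covers.  F is a forest, so it has as many
-- components as there are minimal elements, say d; weighting each component by its rank
-- moreover gives |P| ≤ d².
--
-- A proximal vine all of whose F_i are connected is an R-vine: its components correspond to the
-- ranks, so d is the maximal rank.  In a principal ideal connectedness of F_{i+1} passes down to
-- F_i, because by proximity adjacent vertices of F_{i+1} are edges of F_i with a common end.
-- If in a proximal vine some F_i is disconnected, then two elements of equal rank lie in different
-- components and are either minimal or cover a common element; a new maximal element
-- covering exactly these two gives a larger proximal vine with the same d.  By the
-- bound d² this stops, at an R-vine containing P as an ideal.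

open import Defs
open import Data.Empty using (⊥; ⊥-elim)
open import Data.Fin using (Fin; inject₁; fromℕ; fromℕ<; punchIn; toℕ)
  renaming (zero to fzero; suc to fsuc)
open import Data.Fin.Properties
  using (_≟_; any?; injective⇒≤; inject₁-injective; toℕ-inject₁; punchInᵢ≢i;
         suc-injective; toℕ-injective; toℕ-fromℕ<; toℕ<n)
open import Data.Nat using (ℕ; zero; suc; pred; _+_; _∸_; _*_; _≤_; _<_; _⊔_; z≤n; s≤s)
open import Data.Nat.Properties
  using (≤-refl; ≤-reflexive; ≤-trans; ≤-antisym; ≤-pred; <-irrefl; <-trans; <-≤-trans; <⇒≤;
         n<1+n; n≤1+n; m≤m⊔n; m≤n⊔m; ⊔-sel; m≤m+n; m≤n+m; m∸n+n≡m; +-comm; +-assoc;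
         +-identityʳ; +-suc; +-cancelʳ-≡; +-mono-≤; +-monoʳ-≤; *-monoʳ-≤; *-identityʳ;
         *-distribʳ-+; +-0-commutativeMonoid; module ≤-Reasoning)
  renaming (_≟_ to _≟ℕ_; suc-injective to ℕ-suc-injective)
open import Algebra.Properties.CommutativeMonoid.Sum +-0-commutativeMonoid
  using (sum; sum-cong-≗; sum-remove; ∑-distrib-+)
open import Data.Product using (∃₂; ∃-syntax; _×_; _,_; proj₁; proj₂)
open import Data.Sum using (_⊎_; inj₁; inj₂; [_,_]′; swap)
open import Data.Unit using (⊤; tt)
open import Data.Vec.Functional as VF using (removeAt)
open import Function using (_∘_; id; _⇔_; mk⇔)
open import Function.Definitions using (Injective)
open import Relation.Binary.Construct.Closure.ReflexiveTransitive
  using (Star; ε; _◅_; _◅◅_; reverse; gmap)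
open import Relation.Binary.PropositionalEquality
  using (_≡_; _≢_; refl; sym; trans; cong; cong₂; subst; module ≡-Reasoning)
open import Relation.Nullary using (¬_; Dec; yes; no; contradiction; ¬?)
open import Relation.Nullary.Decidable using (_×-dec_; _⊎-dec_; map′)
open import Relation.Unary using (Decidable)

suc-pred-pos : ∀ {r} → 1 ≤ r → suc (pred r) ≡ r
suc-pred-pos (s≤s _) = refl

-- Counting

indicator : {A : Set} → Dec A → ℕ
indicator (yes _) = 1
indicator (no _)  = 0

indicator-yes : ∀ {A : Set} (a? : Dec A) → A → indicator a? ≡ 1
indicator-yes (yes _) _ = refl
indicator-yes (no ¬a) a = contradiction a ¬a

indicator-no : ∀ {A : Set} (a? : Dec A) → ¬ A → indicator a? ≡ 0
indicator-no (yes a) ¬a = contradiction a ¬a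
indicator-no (no _)  _  = refl

indicator-cong : ∀ {A B : Set} (a? : Dec A) (b? : Dec B) → (A → B) → (B → A) →
                 indicator a? ≡ indicator b?
indicator-cong (yes a) b? f g = sym (indicator-yes b? (f a))
indicator-cong (no ¬a) b? f g = sym (indicator-no b? (¬a ∘ g))

count : ∀ {m} {Q : Fin m → Set} → Decidable Q → ℕ
count Q? = sum (indicator ∘ Q?)

HasCard-count : ∀ {m} {Q : Fin m → Set} (Q? : Decidable Q) → HasCard Q (count Q?)
HasCard-count {zero} Q? = (λ ()) , (λ { {()} }) , (λ ()) , (λ ())
HasCard-count {suc m} Q? with Q? fzero | HasCard-count (Q? ∘ fsuc)
... | yes q | e , e-inj , e-Q , e-sur = e′ , inj′ , Q′ , sur′
  where
  e′ : Fin (suc _) → Fin (suc m)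
  e′ fzero    = fzero
  e′ (fsuc j) = fsuc (e j)
  inj′ : Injective _≡_ _≡_ e′
  inj′ {fzero}  {fzero}  _  = refl
  inj′ {fzero}  {fsuc _} ()
  inj′ {fsuc _} {fzero}  ()
  inj′ {fsuc _} {fsuc _} eq = cong fsuc (e-inj (suc-injective eq))
  Q′ : ∀ j → _
  Q′ fzero    = q
  Q′ (fsuc j) = e-Q j
  sur′ : ∀ x → _ → ∃[ j ] e′ j ≡ x
  sur′ fzero    _  = fzero , refl
  sur′ (fsuc x) qx with e-sur x qx
  ... | j , eq = fsuc j , cong fsuc eq
... | no ¬q | e , e-inj , e-Q , e-sur =
  fsuc ∘ e , e-inj ∘ suc-injective , e-Q , sur′
  where
  sur′ : ∀ x → _ → ∃[ j ] fsuc (e j) ≡ x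
  sur′ fzero    q  = contradiction q ¬q
  sur′ (fsuc x) qx with e-sur x qx
  ... | j , eq = j , cong fsuc eq

HasCard-≤ : ∀ {m k l} {Q : Fin m → Set} → HasCard Q k →
            (g : Fin l → Fin m) → Injective _≡_ _≡_ g → (∀ j → Q (g j)) → l ≤ k
HasCard-≤ (e , _ , _ , sur) g g-inj g-Q = injective⇒≤ {f = λ j → proj₁ (sur (g j) (g-Q j))} inj
  where
  inj : Injective _≡_ _≡_ (λ j → proj₁ (sur (g j) (g-Q j)))
  inj {i} {j} eq =
    g-inj (trans (sym (proj₂ (sur (g i) (g-Q i)))) (trans (cong e eq) (proj₂ (sur (g j) (g-Q j)))))

HasCard-unique : ∀ {m k l} {Q : Fin m → Set} → HasCard Q k → HasCard Q l → k ≡ l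
HasCard-unique c@(e , inj , q , _) c′@(e′ , inj′ , q′ , _) =
  ≤-antisym (HasCard-≤ c′ e inj q) (HasCard-≤ c e′ inj′ q′)

sum-mono-≤ : ∀ {m} (f g : Fin m → ℕ) → (∀ x → f x ≤ g x) → sum f ≤ sum g
sum-mono-≤ {zero}  f g f≤g = z≤n
sum-mono-≤ {suc m} f g f≤g = +-mono-≤ (f≤g fzero) (sum-mono-≤ (f ∘ fsuc) (g ∘ fsuc) (f≤g ∘ fsuc))

sum-*-distribʳ : ∀ {m} (f : Fin m → ℕ) c → sum (λ x → f x * c) ≡ sum f * c
sum-*-distribʳ {zero}  f c = refl
sum-*-distribʳ {suc m} f c =
  trans (cong (f fzero * c +_) (sum-*-distribʳ (f ∘ fsuc) c)) (sym (*-distribʳ-+ c (f fzero) _))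

sum-one : ∀ m → sum {m} (λ _ → 1) ≡ m
sum-one zero    = refl
sum-one (suc m) = cong suc (sum-one m)

-- Meant for the merging of two components: `k` is the root that disappears, and the other roots
-- keep their weights.
sum-drop : ∀ {m} (f g : Fin m → ℕ) k → f k ≡ 0 → (∀ x → x ≢ k → f x ≡ g x) →
           sum f + g k ≡ sum g
sum-drop {suc m} f g k fk≡0 f≗g = begin
  sum f + g k                      ≡⟨ cong (_+ g k) (sum-remove {i = k} f) ⟩
  f k + sum (removeAt f k) + g k   ≡⟨ cong (λ z → z + sum (removeAt f k) + g k) fk≡0 ⟩
  sum (removeAt f k) + g k         ≡⟨ +-comm _ (g k) ⟩
  g k + sum (removeAt f k)         ≡⟨ cong (g k +_) (sum-cong-≗ (λ j → f≗g (punchIn k j) (punchInᵢ≢i k j))) ⟩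
  g k + sum (removeAt g k)         ≡⟨ sum-remove {i = k} g ⟨
  sum g                            ∎
  where open ≡-Reasoning

-- Components of the covering forests

module Graded (P : GradedPoset) where
  X = Fin (n P)

  open GradedPoset P using () renaming (_≼_ to _⊑_; _≺_ to _⊏_; _⋖_ to _◁_) public

  rk-mono : ∀ {x y} → x ⊑ y → rk P x ≤ rk P y
  rk-mono {x} {y} x⊑y with x ≟ y
  ... | yes refl = ≤-refl
  ... | no x≢y   = <⇒≤ (rk-strict P (x⊑y , x≢y))

  top-rank : ∀ {x y} → x ⊑ y → rk P x ≡ rk P y → x ≡ y
  top-rank {x} {y} x⊑y eq with x ≟ y
  ... | yes x≡y = x≡y
  ... | no x≢y  = contradiction (rk-strict P (x⊑y , x≢y)) (<-irrefl eq)

  rk≡1⇒minimal : ∀ {x} → rk P x ≡ 1 → IsMinimal P x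
  rk≡1⇒minimal {x} eq y y⊑x =
    top-rank y⊑x (≤-antisym (rk-mono y⊑x) (subst (_≤ rk P y) (sym eq) (rk-pos P y)))

  ◁⇒2≤rk : ∀ {x y} → x ◁ y → 2 ≤ rk P y
  ◁⇒2≤rk {x} x◁y = subst (2 ≤_) (sym (rk-cover P x◁y)) (s≤s (rk-pos P x))

  CoverPair-sym : ∀ {v a b} → CoverPair P v a b → CoverPair P v b a
  CoverPair-sym (a≢b , av , bv , all) = a≢b ∘ sym , bv , av , λ c cv → swap (all c cv)

  CoverPair-rk : ∀ {v a b} → CoverPair P v a b → rk P a ≡ rk P b
  CoverPair-rk (_ , av , bv , _) = ℕ-suc-injective (trans (sym (rk-cover P av)) (rk-cover P bv))

  CoverPair-match : ∀ {v a b c d} → CoverPair P v a b → c ◁ v → d ◁ v → c ≢ d →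
                    (c ≡ a × d ≡ b) ⊎ (c ≡ b × d ≡ a)
  CoverPair-match (_ , _ , _ , all) cv dv c≢d with all _ cv | all _ dv
  ... | inj₁ refl | inj₁ refl = contradiction refl c≢d
  ... | inj₁ refl | inj₂ refl = inj₁ (refl , refl)
  ... | inj₂ refl | inj₁ refl = inj₂ (refl , refl)
  ... | inj₂ refl | inj₂ refl = contradiction refl c≢d

  CoverPair-of-covers : ∀ {v a b c d} → CoverPair P v a b → c ◁ v → d ◁ v → c ≢ d →
                        CoverPair P v c d
  CoverPair-of-covers p cv dv c≢d with CoverPair-match p cv dv c≢d
  ... | inj₁ (refl , refl) = p
  ... | inj₂ (refl , refl) = CoverPair-sym p

  toFEdge : ∀ {i v a b} → rk P a ≡ i → CoverPair P v a b → FEdge P i v a b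
  toFEdge eq p@(_ , av , _ , _) =
    trans (rk-cover P av) (cong suc eq) , eq , trans (sym (CoverPair-rk p)) eq , p

  -- Edges come as an indexed family so that they can be added one at a time. With the family `id`
  -- every element is offered as an edge, and the minimal ones join nothing.
  Adjacent : ∀ {k} → (Fin k → X) → X → X → Set
  Adjacent e x y = ∃[ j ] CoverPair P (e j) x y

  Joined : ∀ {k} → (Fin k → X) → X → X → Set
  Joined e = Star (Adjacent e)

  Connected : X → X → Set
  Connected = Joined id

  Joined-sym : ∀ {k} {e : Fin k → X} {x y} → Joined e x y → Joined e y x
  Joined-sym = reverse (λ (j , p) → j , CoverPair-sym p)

  Joined-rk : ∀ {k} {e : Fin k → X} {x y} → Joined e x y → rk P x ≡ rk P y
  Joined-rk ε             = refl
  Joined-rk ((_ , p) ◅ s) = trans (CoverPair-rk p) (Joined-rk s)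

  Joined-weaken : ∀ {k} {e : Fin (suc k) → X} {x y} → Joined (e ∘ fsuc) x y → Joined e x y
  Joined-weaken = gmap id (λ (j , p) → fsuc j , p)

  Connected⇒Walk : ∀ {i x y} → rk P x ≡ i → Connected x y → Walk P i x y
  Connected⇒Walk _  ε             = here
  Connected⇒Walk eq ((v , p) ◅ s) =
    step v (toFEdge eq p) (Connected⇒Walk (trans (sym (CoverPair-rk p)) eq) s)

  -- A `Cycle` without its closing edge. The indices `js` record that all edges come from `e`, so an
  -- element outside `e` is a new edge.
  record SimplePath {l} (i : ℕ) (e : Fin l → X) (x z : X) : Set where
    field
      len     : ℕ
      vs      : Fin (suc len) → X
      vs-inj  : Injective _≡_ _≡_ vs
      js      : Fin len → Fin l
      edge    : ∀ t → FEdge P i (e (js t)) (vs (inject₁ t)) (vs (fsuc t))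
      starts  : vs fzero ≡ x
      ends    : vs (fromℕ len) ≡ z
  open SimplePath

  suffix : ∀ {l i} {e : Fin l → X} {x z} (p : SimplePath i e x z) (t : Fin (suc (len p))) →
           SimplePath i e (vs p t) z
  suffix p fzero = record
    { len = len p; vs = vs p; vs-inj = vs-inj p; js = js p; edge = edge p; starts = refl; ends = ends p }
  suffix record { len = suc k ; vs = vs ; vs-inj = vs-inj ; js = js ; edge = edge ; ends = ends } (fsuc t) =
    suffix record { len = k ; vs = vs ∘ fsuc ; vs-inj = suc-injective ∘ vs-inj ; js = js ∘ fsuc
                  ; edge = edge ∘ fsuc ; starts = refl ; ends = ends } t

  simplePath : ∀ {l i} {e : Fin l → X} {x z} → rk P x ≡ i → Joined e x z → SimplePath i e x z
  simplePath {x = x} _ ε = record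
    { len = 0 ; vs = λ _ → x ; vs-inj = λ { {fzero} {fzero} _ → refl }
    ; js = λ () ; edge = λ () ; starts = refl ; ends = refl }
  simplePath {l} {i} {e} {x} {z} eq ((j , c) ◅ s) = extend (any? (λ t → vs p t ≟ x))
    where
    p : SimplePath i e _ z
    p = simplePath (trans (sym (CoverPair-rk c)) eq) s
    extend : Dec (∃[ t ] vs p t ≡ x) → SimplePath i e x z
    -- The path already visits `x`, so the loop from `x` back to `x` is cut off.
    extend (yes (t , t≡x)) = subst (λ y → SimplePath i e y z) t≡x (suffix p t)
    extend (no x∉) = record
      { len = suc (len p) ; vs = vs′ ; vs-inj = inj′ ; js = js′ ; edge = edge′
      ; starts = refl ; ends = ends p }
      where
      vs′ : Fin (suc (suc (len p))) → X
      vs′ fzero    = x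
      vs′ (fsuc t) = vs p t
      inj′ : Injective _≡_ _≡_ vs′
      inj′ {fzero}  {fzero}  _  = refl
      inj′ {fzero}  {fsuc t} eq = contradiction (t , sym eq) x∉
      inj′ {fsuc t} {fzero}  eq = contradiction (t , eq) x∉
      inj′ {fsuc _} {fsuc _} eq = cong fsuc (vs-inj p eq)
      js′ : Fin (suc (len p)) → Fin l
      js′ fzero    = j
      js′ (fsuc t) = js p t
      edge′ : ∀ t → FEdge P i (e (js′ t)) (vs′ (inject₁ t)) (vs′ (fsuc t))
      edge′ fzero    = toFEdge eq (subst (CoverPair P (e j) x) (sym (starts p)) c)
      edge′ (fsuc t) = edge p t

  -- An edge determines its two ends. If edges `s` and `t` coincide with the same orientation,
  -- injectivity of `xs` gives `s ≡ t`; with opposite orientations each index would be the successor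
  -- of the other.
  edges-distinct : ∀ {k i} {xs : Fin (suc k) → X} {es : Fin k → X} → Injective _≡_ _≡_ xs →
                   (∀ t → FEdge P i (es t) (xs (inject₁ t)) (xs (fsuc t))) → Injective _≡_ _≡_ es
  edges-distinct {xs = xs} {es} xs-inj edge {s} {t} es≡
    with CoverPair-match c (subst (_ ◁_) (sym es≡) d₁) (subst (_ ◁_) (sym es≡) d₂) d₁≢d₂
    where
    c = proj₂ (proj₂ (proj₂ (edge s)))
    d = proj₂ (proj₂ (proj₂ (edge t)))
    d₁≢d₂ = proj₁ d
    d₁ = proj₁ (proj₂ d)
    d₂ = proj₁ (proj₂ (proj₂ d))
  ... | inj₁ (eq , _)  = sym (inject₁-injective (xs-inj eq))
  ... | inj₂ (eq , eq′) = contradiction s<s (<-irrefl refl)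
    where
    t≡1+s : toℕ t ≡ suc (toℕ s)
    t≡1+s = trans (sym (toℕ-inject₁ t)) (cong toℕ (xs-inj eq))
    1+t≡s : suc (toℕ t) ≡ toℕ s
    1+t≡s = trans (cong toℕ (xs-inj eq′)) (toℕ-inject₁ s)
    s<s : toℕ s < toℕ s
    s<s = <-trans (subst (toℕ s <_) (sym t≡1+s) (n<1+n _)) (subst (toℕ t <_) 1+t≡s (n<1+n _))

  -- A simple path from `a` to `b` with edges in `e` is closed by `v`. It has at least one edge
  -- because `a ≢ b`.
  closing-cycle : ∀ {l} {e : Fin l → X} {v a b} → (∀ j → e j ≢ v) → CoverPair P v a b →
                  Joined e a b → Cycle P (rk P a)
  closing-cycle {e = e} {v} {a} {b} v∉e c@(a≢b , _) s = record
    { k = len p ; k≥1 = nonempty p ; xs = vs p ; xs-inj = vs-inj p ; es = e ∘ js p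
    ; es-inj = edges-distinct {es = e ∘ js p} (vs-inj p) (edge p)
    ; eLast = v ; eLast-new = v∉e ∘ js p ; es-edge = edge p
    ; eLast-edge = toFEdge (trans (cong (rk P) (ends p)) (sym (CoverPair-rk c))) c′ }
    where
    p : SimplePath (rk P a) e a b
    p = simplePath refl s
    nonempty : (q : SimplePath (rk P a) e a b) → 1 ≤ len q
    nonempty record { len = zero ; starts = s ; ends = t } = contradiction (trans (sym s) t) a≢b
    nonempty record { len = suc _ } = s≤s z≤n
    c′ : CoverPair P v (vs p (fromℕ (len p))) (vs p fzero)
    c′ rewrite starts p | ends p = CoverPair-sym c

  -- The edges e j are added one at a time.  Adding a non-minimal v merges two components and
  -- loses one representative, of rank rk v - 1; since w 0 = 0, minimal v contribute nothing.
  record Components {k} (e : Fin k → X) : Set where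
    field
      rep      : X → X
      rep-idem : ∀ x → rep (rep x) ≡ rep x
      rep-join : ∀ x → Joined e x (rep x)
      rep-edge : ∀ j {a b} → CoverPair P (e j) a b → rep a ≡ rep b
      weights  : ∀ (w : ℕ → ℕ) → w 0 ≡ 0 →
                 sum (λ x → indicator (rep x ≟ x) * w (rk P x)) + sum (λ j → w (pred (rk P (e j))))
                   ≡ sum (w ∘ rk P)

    rep-rk : ∀ x → rk P (rep x) ≡ rk P x
    rep-rk x = sym (Joined-rk (rep-join x))

    rep-≡⇒Joined : ∀ {x y} → rep x ≡ rep y → Joined e x y
    rep-≡⇒Joined {x} {y} eq = rep-join x ◅◅ subst (λ z → Joined e z y) (sym eq) (Joined-sym (rep-join y))

    Joined⇒rep-≡ : ∀ {x y} → Joined e x y → rep x ≡ rep y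
    Joined⇒rep-≡ ε             = refl
    Joined⇒rep-≡ ((j , p) ◅ s) = trans (rep-edge j p) (Joined⇒rep-≡ s)

  -- The component of `b` is absorbed into that of `a`: `redirect` sends the root `β` to `α` and
  -- fixes everything else, so `β` is the only root lost.
  merge : ∀ {k} {e : Fin (suc k) → X} {a b} (C : Components (e ∘ fsuc)) → let open Components C in
          CoverPair P (e fzero) a b → rep a ≢ rep b → Components e
  merge {k} {e} {a} {b} C c α≢β = record
    { rep = redirect ∘ rep
    ; rep-idem = λ x → redirect-idem (rep x) (rep-idem x)
    ; rep-join = join
    ; rep-edge = λ { fzero p → edge₀ p ; (fsuc j) p → cong redirect (rep-edge j p) }
    ; weights = weights′
    }
    where
    open Components C
    α = rep a
    β = rep b

    redirect : X → X
    redirect y with y ≟ β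
    ... | yes _ = α
    ... | no _  = y

    redirect-β : redirect β ≡ α
    redirect-β with β ≟ β
    ... | yes _   = refl
    ... | no β≢β = contradiction refl β≢β

    redirect-≢ : ∀ {y} → y ≢ β → redirect y ≡ y
    redirect-≢ {y} y≢β with y ≟ β
    ... | yes y≡β = contradiction y≡β y≢β
    ... | no _    = refl

    redirect-idem : ∀ y → rep y ≡ y → redirect (rep (redirect y)) ≡ redirect y
    redirect-idem y eq with y ≟ β
    ... | yes _  = trans (cong redirect (rep-idem a)) (redirect-≢ α≢β)
    ... | no y≢β = trans (cong redirect eq) (redirect-≢ y≢β)

    redirect-join : ∀ y → Joined e y (redirect y)
    redirect-join y with y ≟ β
    ... | yes refl = Joined-sym (Joined-weaken (rep-join b)) ◅◅ (fzero , CoverPair-sym c)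
                       ◅ Joined-weaken (rep-join a)
    ... | no _     = ε

    join : ∀ x → Joined e x (redirect (rep x))
    join x = Joined-weaken (rep-join x) ◅◅ redirect-join (rep x)

    edge₀ : ∀ {x y} → CoverPair P (e fzero) x y → redirect (rep x) ≡ redirect (rep y)
    edge₀ p with CoverPair-match p (proj₁ (proj₂ c)) (proj₁ (proj₂ (proj₂ c))) (proj₁ c)
    ... | inj₁ (refl , refl) = trans (redirect-≢ α≢β) (sym redirect-β)
    ... | inj₂ (refl , refl) = trans redirect-β (sym (redirect-≢ α≢β))

    root⇒root′ : ∀ {x} → x ≢ β → rep x ≡ x → redirect (rep x) ≡ x
    root⇒root′ x≢β eq = trans (cong redirect eq) (redirect-≢ x≢β)

    root′⇒root : ∀ {x} → x ≢ β → redirect (rep x) ≡ x → rep x ≡ x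
    root′⇒root {x} x≢β eq with rep x ≟ β
    -- Here `x` would be `α`, whose root is `α` and not `β`.
    ... | yes p = contradiction (trans (trans (sym (rep-idem a)) (cong rep eq)) p) α≢β
    ... | no _  = eq

    weights′ : ∀ (w : ℕ → ℕ) → w 0 ≡ 0 →
               sum (λ x → indicator (redirect (rep x) ≟ x) * w (rk P x)) + sum (λ j → w (pred (rk P (e j))))
                 ≡ sum (w ∘ rk P)
    weights′ w w0 = begin
      sum new + (w (pred (rk P (e fzero))) + rest)
        ≡⟨ cong (λ z → sum new + (z + rest)) wβ ⟩
      sum new + (old β + rest)
        ≡⟨ +-assoc (sum new) (old β) rest ⟨
      sum new + old β + rest
        ≡⟨ cong (_+ rest) (sum-drop new old β newβ new≗old) ⟩
      sum old + rest
        ≡⟨ weights w w0 ⟩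
      sum (w ∘ rk P) ∎
      where
      open ≡-Reasoning
      new old : X → ℕ
      new x = indicator (redirect (rep x) ≟ x) * w (rk P x)
      old x = indicator (rep x ≟ x) * w (rk P x)
      rest : ℕ
      rest = sum (λ j → w (pred (rk P (e (fsuc j)))))
      -- The new edge has rank one more than `b`, and `β` has the rank of `b`. Hence the edge brings
      -- in exactly the weight that the root `β` takes away.
      wβ : w (pred (rk P (e fzero))) ≡ old β
      wβ = begin
        w (pred (rk P (e fzero)))  ≡⟨ cong (w ∘ pred) (rk-cover P (proj₁ (proj₂ (proj₂ c)))) ⟩
        w (rk P b)                 ≡⟨ cong w (rep-rk b) ⟨
        w (rk P β)                 ≡⟨ +-identityʳ _ ⟨
        1 * w (rk P β)             ≡⟨ cong (_* w (rk P β)) (indicator-yes (rep β ≟ β) (rep-idem b)) ⟨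
        old β                      ∎
      newβ : new β ≡ 0
      newβ = cong (_* w (rk P β))
        (indicator-no (redirect (rep β) ≟ β)
          (λ eq → α≢β (trans (trans (sym redirect-β) (cong redirect (sym (rep-idem b)))) eq)))
      new≗old : ∀ x → x ≢ β → new x ≡ old x
      new≗old x x≢β = cong (_* w (rk P x))
        (indicator-cong (redirect (rep x) ≟ x) (rep x ≟ x) (root′⇒root x≢β) (root⇒root′ x≢β))

-- Ideals

module Ideal {Q P : GradedPoset} {f : Fin (n Q) → Fin (n P)} (emb : IsIdealEmbedding Q P f) where
  private
    module Q = Graded Q
    module P = Graded P

  f-inj : Injective _≡_ _≡_ f
  f-inj = proj₁ emb

  f-mono : ∀ {x y} → x Q.⊑ y → f x P.⊑ f y
  f-mono {x} {y} = proj₁ (proj₁ (proj₂ emb) x y)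

  f-reflect : ∀ {x y} → f x P.⊑ f y → x Q.⊑ y
  f-reflect {x} {y} = proj₂ (proj₁ (proj₂ emb) x y)

  f-rk : ∀ x → rk P (f x) ≡ rk Q x
  f-rk = proj₁ (proj₂ (proj₂ emb))

  f-down : ∀ {x z} → z P.⊑ f x → ∃[ y ] f y ≡ z
  f-down {x} {z} = proj₂ (proj₂ (proj₂ emb)) x z

  ⊏-push : ∀ {x y} → x Q.⊏ y → f x P.⊏ f y
  ⊏-push (x⊑y , x≢y) = f-mono x⊑y , x≢y ∘ f-inj

  ⊏-pull : ∀ {x y} → f x P.⊏ f y → x Q.⊏ y
  ⊏-pull (x⊑y , x≢y) = f-reflect x⊑y , x≢y ∘ cong f

  ◁-push : ∀ {x y} → x Q.◁ y → f x P.◁ f y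
  ◁-push (x⊏y , no-between) = ⊏-push x⊏y , λ z x⊏z z⊏y → between z x⊏z z⊏y
    where
    between : ∀ z → f _ P.⊏ z → z P.⊏ f _ → ⊥
    -- An element strictly between the images lies below `f y`, hence is itself an image.
    between z x⊏z z⊏y with f-down (proj₁ z⊏y)
    ... | z′ , refl = no-between z′ (⊏-pull x⊏z) (⊏-pull z⊏y)

  ◁-pull : ∀ {x y} → f x P.◁ f y → x Q.◁ y
  ◁-pull (x⊏y , no-between) = ⊏-pull x⊏y , λ z x⊏z z⊏y → no-between (f z) (⊏-push x⊏z) (⊏-push z⊏y)

  ◁-down : ∀ {x z} → z P.◁ f x → ∃[ y ] (f y ≡ z × y Q.◁ x)
  ◁-down zx with f-down (proj₁ (proj₁ zx))
  ... | y , refl = y , refl , ◁-pull zx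

  CoverPair-push : ∀ {v a b} → CoverPair Q v a b → CoverPair P (f v) (f a) (f b)
  CoverPair-push {v} {a} {b} (a≢b , av , bv , all) = a≢b ∘ f-inj , ◁-push av , ◁-push bv , all′
    where
    all′ : ∀ c → c P.◁ f v → c ≡ f a ⊎ c ≡ f b
    all′ c cv with ◁-down cv
    ... | c′ , refl , c′v with all c′ c′v
    ...   | inj₁ eq = inj₁ (cong f eq)
    ...   | inj₂ eq = inj₂ (cong f eq)

  CoverPair-pull : ∀ {v a b} → CoverPair P (f v) (f a) (f b) → CoverPair Q v a b
  CoverPair-pull (a≢b , av , bv , all) =
    a≢b ∘ cong f , ◁-pull av , ◁-pull bv ,
    λ c cv → [ inj₁ ∘ f-inj , inj₂ ∘ f-inj ]′ (all (f c) (◁-push cv))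

  CoverPair-down : ∀ {v a b} → CoverPair P (f v) a b → ∃₂ λ a′ b′ → f a′ ≡ a × f b′ ≡ b × CoverPair Q v a′ b′
  CoverPair-down p@(_ , av , bv , _) with ◁-down av | ◁-down bv
  ... | a′ , refl , _ | b′ , refl , _ = a′ , b′ , refl , refl , CoverPair-pull p

  FEdge-push : ∀ {i v a b} → FEdge Q i v a b → FEdge P i (f v) (f a) (f b)
  FEdge-push {v = v} {a} {b} (rv , ra , rb , p) =
    trans (f-rk v) rv , trans (f-rk a) ra , trans (f-rk b) rb , CoverPair-push p

  FEdge-pull : ∀ {i v a b} → FEdge P i (f v) (f a) (f b) → FEdge Q i v a b
  FEdge-pull {v = v} {a} {b} (rv , ra , rb , p) =
    trans (sym (f-rk v)) rv , trans (sym (f-rk a)) ra , trans (sym (f-rk b)) rb , CoverPair-pull p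

  Cycle-push : ∀ {i} → Cycle Q i → Cycle P i
  Cycle-push c = record
    { k = k ; k≥1 = k≥1 ; xs = f ∘ xs ; xs-inj = xs-inj ∘ f-inj ; es = f ∘ es ; es-inj = es-inj ∘ f-inj
    ; eLast = f eLast ; eLast-new = λ j → eLast-new j ∘ f-inj
    ; es-edge = FEdge-push ∘ es-edge ; eLast-edge = FEdge-push eLast-edge }
    where open Cycle c

  -- It suffices that the edges lie in the image, since each vertex is below an edge: `xs fzero` is
  -- the second end of the closing edge, and `xs (fsuc j)` that of `es j`.
  Cycle-pull : ∀ {i} (c : Cycle P i) → (∀ j → ∃[ v ] f v ≡ Cycle.es c j) → ∃[ v ] f v ≡ Cycle.eLast c →
               Cycle Q i
  Cycle-pull {i} c es-in (eL , eL≡) = record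
    { k = k ; k≥1 = k≥1 ; xs = xs′
    ; xs-inj = λ {s} {t} eq → xs-inj (trans (sym (fxs s)) (trans (cong f eq) (fxs t)))
    ; es = es′
    ; es-inj = λ {s} {t} eq → es-inj (trans (sym (fes s)) (trans (cong f eq) (fes t)))
    ; eLast = eL
    ; eLast-new = λ j eq → eLast-new j (trans (sym (fes j)) (trans (cong f eq) eL≡))
    ; es-edge = λ j → FEdge-pull (retype (fes j) (fxs (inject₁ j)) (fxs (fsuc j)) (es-edge j))
    ; eLast-edge = FEdge-pull (retype eL≡ (fxs (fromℕ k)) (fxs fzero) eLast-edge) }
    where
    open Cycle c
    es′ : Fin k → Fin (n Q)
    es′ = proj₁ ∘ es-in
    fes : ∀ j → f (es′ j) ≡ es j
    fes = proj₂ ∘ es-in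
    below : ∀ {v a b} → ∃[ v′ ] f v′ ≡ v → FEdge P i v a b → ∃[ b′ ] f b′ ≡ b
    below (_ , refl) (_ , _ , _ , _ , _ , bv , _) = f-down (proj₁ (proj₁ bv))
    xs-in : ∀ j → ∃[ x ] f x ≡ xs j
    xs-in fzero    = below (eL , eL≡) eLast-edge
    xs-in (fsuc j) = below (es-in j) (es-edge j)
    xs′ : Fin (suc k) → Fin (n Q)
    xs′ = proj₁ ∘ xs-in
    fxs : ∀ j → f (xs′ j) ≡ xs j
    fxs = proj₂ ∘ xs-in
    retype : ∀ {v v′ a a′ b b′} → v′ ≡ v → a′ ≡ a → b′ ≡ b → FEdge P i v a b → FEdge P i v′ a′ b′
    retype refl refl refl e = e

  -- The common element supplied by `P` lies below an image, so it belongs to the ideal.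
  proximity : Proximity P → Proximity Q
  proximity prox a b a≢b ra≡rb 2≤ra (v , av , bv)
    with prox (f a) (f b) (a≢b ∘ f-inj) (trans (f-rk a) (trans ra≡rb (sym (f-rk b))))
              (subst (2 ≤_) (sym (f-rk a)) 2≤ra) (f v , ◁-push av , ◁-push bv)
  ... | c , ca , cb with ◁-down ca
  ...   | c′ , refl , c′a = c′ , c′a , ◁-pull cb

  minimal-pull : ∀ {x} → IsMinimal P (f x) → IsMinimal Q x
  minimal-pull min y y⊑x = f-inj (min (f y) (f-mono y⊑x))

IsIdealEmbedding-trans : ∀ {O Q P} {f : Fin (n O) → Fin (n Q)} {g : Fin (n Q) → Fin (n P)} →
                         IsIdealEmbedding O Q f → IsIdealEmbedding Q P g → IsIdealEmbedding O P (g ∘ f)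
IsIdealEmbedding-trans {O} {Q} {P} {f} {g} F G =
  F.f-inj ∘ G.f-inj ,
  (λ x y → G.f-mono ∘ F.f-mono , F.f-reflect ∘ G.f-reflect) ,
  (λ x → trans (G.f-rk (f x)) (F.f-rk x)) ,
  down
  where
  module F = Ideal {O} {Q} F
  module G = Ideal {Q} {P} G
  down : ∀ x z → _≼_ P z (g (f x)) → ∃[ y ] g (f y) ≡ z
  down x z z⊑ with G.f-down z⊑
  ... | y , refl with F.f-down (G.f-reflect z⊑)
  ...   | y′ , refl = y′ , refl

-- Proximal vines

foldr-max-upper : ∀ {m k} (r : Fin m → ℕ) (xs : Fin k → Fin m) j →
                  r (xs j) ≤ VF.foldr (λ x h → r x ⊔ h) 0 xs
foldr-max-upper r xs fzero    = m≤m⊔n (r (xs fzero)) _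
foldr-max-upper r xs (fsuc j) = ≤-trans (foldr-max-upper r (xs ∘ fsuc) j) (m≤n⊔m (r (xs fzero)) _)

foldr-max-attained : ∀ {m k} (r : Fin m → ℕ) (xs : Fin k → Fin m) {i} →
                     i < VF.foldr (λ x h → r x ⊔ h) 0 xs → ∃[ j ] i < r (xs j)
foldr-max-attained {k = suc k} r xs {i} i<
  with ⊔-sel (r (xs fzero)) (VF.foldr (λ x h → r x ⊔ h) 0 (xs ∘ fsuc))
... | inj₁ eq = fzero , subst (i <_) eq i<
... | inj₂ eq with foldr-max-attained r (xs ∘ fsuc) (subst (i <_) eq i<)
...   | j , i<r = fsuc j , i<r

module Vine (P : GradedPoset) (V : IsVine P) where
  open Graded P public

  rk≤max : ∀ x → rk P x ≤ maxRank P
  rk≤max = foldr-max-upper (rk P) id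

  -- A cycle bounds its own level: its vertices have rank `i ≥ 1`, and its edges have rank `suc i`,
  -- at most the maximal rank.
  forest : ∀ i → IsForest P i
  forest i c = proj₂ (proj₂ V) i 1≤i i≤max c
    where
    open Cycle c
    1≤i : 1 ≤ i
    1≤i = subst (1 ≤_) (proj₁ (proj₂ eLast-edge)) (rk-pos P _)
    i≤max : i ≤ maxRank P
    i≤max = ≤-trans (n≤1+n i) (subst (_≤ maxRank P) (proj₁ eLast-edge) (rk≤max eLast))

  minimal⇒rk≡1 : ∀ {x} → IsMinimal P x → rk P x ≡ 1
  minimal⇒rk≡1 = rk-min P _

  coverPair : ∀ v → rk P v ≢ 1 → ∃₂ (CoverPair P v)
  coverPair v rv≢1 = proj₁ V v (rv≢1 ∘ minimal⇒rk≡1)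

  ◁⇒coverPair : ∀ {x v} → x ◁ v → ∃₂ (CoverPair P v)
  ◁⇒coverPair xv = coverPair _ (λ eq → <-irrefl (sym eq) (◁⇒2≤rk xv))

  CoverPair-of : ∀ {v a b} → a ◁ v → b ◁ v → a ≢ b → CoverPair P v a b
  CoverPair-of av bv a≢b = CoverPair-of-covers (proj₂ (proj₂ (◁⇒coverPair av))) av bv a≢b

  -- Induction on the number of edges. An element of rank 1 joins nothing and has weight `w 0`. Any
  -- other element joins two different components, since otherwise it would close a cycle;
  -- injectivity of `e` makes it differ from the earlier edges.
  components-of : ∀ {k} (e : Fin k → X) → Injective _≡_ _≡_ e → Components e
  components-of {zero} e e-inj = record
    { rep = id ; rep-idem = λ _ → refl ; rep-join = λ _ → ε ; rep-edge = λ ()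
    ; weights = λ w _ → trans (+-identityʳ _)
        (sum-cong-≗ (λ x → trans (cong (_* w (rk P x)) (indicator-yes (x ≟ x) refl)) (+-identityʳ _))) }
  components-of {suc k} e e-inj with components-of (e ∘ fsuc) (suc-injective ∘ e-inj) | rk P (e fzero) ≟ℕ 1
  ... | C | yes r≡1 = record
    { rep = rep ; rep-idem = rep-idem ; rep-join = Joined-weaken ∘ rep-join
    ; rep-edge = λ { fzero p → contradiction (sym r≡1) (λ eq → <-irrefl eq (◁⇒2≤rk (proj₁ (proj₂ p))))
                   ; (fsuc j) p → rep-edge j p }
    ; weights = λ w w0 → trans
        (cong (λ z → sum (λ x → indicator (rep x ≟ x) * w (rk P x))
                     + (z + sum (λ j → w (pred (rk P (e (fsuc j)))))))
              (trans (cong (w ∘ pred) r≡1) w0))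
        (weights w w0) }
    where open Components C
  ... | C | no r≢1 with coverPair (e fzero) r≢1
  ...   | a , b , c with Components.rep C a ≟ Components.rep C b
  ...     | yes eq = contradiction
              (closing-cycle (λ j eq → contradiction (e-inj eq) λ ()) c (Components.rep-≡⇒Joined C eq)) (forest _)
  ...     | no α≢β = merge C c α≢β

  abstract
    components : Components {n P} id
    components = components-of id id

  open Components components public

  -- Counting the components of a vine

  Root : X → Set
  Root x = rep x ≡ x

  root? : Decidable Root
  root? x = rep x ≟ x

  rank-one? : ∀ x → Dec (rk P x ≡ 1)
  rank-one? x = rk P x ≟ℕ 1

  -- Take weight 1 on positive ranks and 0 at 0. The edges then contribute the number of elements of
  -- rank at least 2, which cancels from the total number of elements.
  roots≡minimals : count root? ≡ count rank-one?
  roots≡minimals = +-cancelʳ-≡ _ (count root?) (count rank-one?) (begin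
    count root? + higher ≡⟨ cong (_+ higher) (sum-cong-≗ (λ x → sym (scale x))) ⟩
    sum (λ x → indicator (root? x) * w (rk P x)) + higher ≡⟨ weights w refl ⟩
    sum (w ∘ rk P) ≡⟨ sum-cong-≗ split ⟩
    sum (λ x → indicator (rank-one? x) + w (pred (rk P x)))
      ≡⟨ ∑-distrib-+ (indicator ∘ rank-one?) (λ x → w (pred (rk P x))) ⟩
    count rank-one? + higher ∎)
    where
    open ≡-Reasoning
    w : ℕ → ℕ
    w zero    = 0
    w (suc _) = 1
    higher : ℕ
    higher = sum (λ x → w (pred (rk P x)))
    w-pos : ∀ {r} → 1 ≤ r → w r ≡ 1
    w-pos (s≤s _) = refl
    scale : ∀ x → indicator (root? x) * w (rk P x) ≡ indicator (root? x)
    scale x = trans (cong (indicator (root? x) *_) (w-pos (rk-pos P x))) (*-identityʳ _)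
    split′ : ∀ r (r≟1 : Dec (r ≡ 1)) → 1 ≤ r → w r ≡ indicator r≟1 + w (pred r)
    split′ (suc zero)    r≟1 _ = sym (trans (+-identityʳ _) (indicator-yes r≟1 refl))
    split′ (suc (suc r)) r≟1 _ = sym (cong (_+ 1) (indicator-no r≟1 λ ()))
    split : ∀ x → w (rk P x) ≡ indicator (rank-one? x) + w (pred (rk P x))
    split x = split′ (rk P x) (rank-one? x) (rk-pos P x)

  -- Take the rank itself as weight: the edges contribute the sum of `rk P x - 1`, which falls short
  -- of the sum of all ranks by one per element.
  size≡root-ranks : sum (λ x → indicator (root? x) * rk P x) ≡ n P
  size≡root-ranks = +-cancelʳ-≡ _ _ (n P) (begin
    sum (λ x → indicator (root? x) * rk P x) + sum (λ x → pred (rk P x)) ≡⟨ weights id refl ⟩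
    sum (rk P) ≡⟨ sum-cong-≗ (λ x → sym (suc-pred-pos (rk-pos P x))) ⟩
    sum (λ x → 1 + pred (rk P x)) ≡⟨ ∑-distrib-+ {n P} (λ _ → 1) (λ x → pred (rk P x)) ⟩
    sum {n P} (λ _ → 1) + sum (λ x → pred (rk P x)) ≡⟨ cong (_+ sum (λ x → pred (rk P x))) (sum-one (n P)) ⟩
    n P + sum (λ x → pred (rk P x)) ∎)
    where
    open ≡-Reasoning

  element-of-rank : ∀ i m x → rk P x ≡ m + suc i → ∃[ y ] rk P y ≡ suc i
  element-of-rank i zero    x eq = x , eq
  element-of-rank i (suc m) x eq
    with coverPair x (λ rx≡1 → m+suc≢0 m (ℕ-suc-injective (trans (sym eq) rx≡1)))
    where
    m+suc≢0 : ∀ m → m + suc i ≢ 0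
    m+suc≢0 zero    ()
    m+suc≢0 (suc _) ()
  ... | a , _ , _ , ax , _ = element-of-rank i m a (ℕ-suc-injective (trans (sym (rk-cover P ax)) eq))

  -- Some element has rank above `toℕ j`; going down through covered elements reaches rank
  -- `suc (toℕ j)`, and `rep` preserves the rank.
  root-of-rank : (j : Fin (maxRank P)) → ∃[ x ] (rk P x ≡ suc (toℕ j) × Root x)
  root-of-rank j with foldr-max-attained (rk P) id (toℕ<n j)
  ... | x , j<rx with element-of-rank (toℕ j) (rk P x ∸ suc (toℕ j)) x (sym (m∸n+n≡m j<rx))
  ...   | y , ry = rep y , trans (rep-rk y) ry , rep-idem y

  representative : Fin (maxRank P) → X
  representative = proj₁ ∘ root-of-rank

  representative-rk : ∀ j → rk P (representative j) ≡ suc (toℕ j)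
  representative-rk = proj₁ ∘ proj₂ ∘ root-of-rank

  representative-root : ∀ j → Root (representative j)
  representative-root = proj₂ ∘ proj₂ ∘ root-of-rank

  representative-inj : Injective _≡_ _≡_ representative
  representative-inj {i} {j} eq = toℕ-injective (ℕ-suc-injective
    (trans (sym (representative-rk i)) (trans (cong (rk P) eq) (representative-rk j))))

  maxRank≤roots : maxRank P ≤ count root?
  maxRank≤roots = HasCard-≤ (HasCard-count root?) representative representative-inj representative-root

  -- The root ranks add up to the size. Each is at most the maximal rank, hence at most the number
  -- of roots, because distinct ranks have distinct roots.
  size-bound : n P ≤ count rank-one? * count rank-one?
  size-bound = begin
    n P                                         ≡⟨ size≡root-ranks ⟨
    sum (λ x → indicator (root? x) * rk P x)
      ≤⟨ sum-mono-≤ _ _ (λ x → *-monoʳ-≤ (indicator (root? x)) (≤-trans (rk≤max x) maxRank≤roots)) ⟩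
    sum (λ x → indicator (root? x) * count root?) ≡⟨ sum-*-distribʳ (indicator ∘ root?) _ ⟩
    count root? * count root?                   ≡⟨ cong₂ _*_ roots≡minimals roots≡minimals ⟩
    count rank-one? * count rank-one?           ∎
    where open ≤-Reasoning

  RankwiseConnected : Set
  RankwiseConnected = ∀ x y → rk P x ≡ rk P y → Connected x y

  -- With all levels connected, a root is determined by its rank. So `representative` enumerates all
  -- roots, and their number, that of the minimal elements, is the maximal rank.
  isRVine : Proximity P → RankwiseConnected → IsRVine P
  isRVine prox conn =
    V , dim , (λ i _ _ → forest i , λ x y rx ry → Connected⇒Walk rx (conn x y (trans rx (sym ry)))) , prox
    where
    surj : ∀ x → Root x → ∃[ j ] representative j ≡ x
    surj x root = j , trans (sym (representative-root j))
                            (trans (Joined⇒rep-≡ (conn (representative j) x same-rank)) root)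
      where
      j : Fin (maxRank P)
      -- The index is `rk P x - 1`, as ranks start at 1.
      j = fromℕ< (≤-trans (≤-reflexive (suc-pred-pos (rk-pos P x))) (rk≤max x))
      same-rank : rk P (representative j) ≡ rk P x
      same-rank = trans (representative-rk j) (trans (cong suc (toℕ-fromℕ< _)) (suc-pred-pos (rk-pos P x)))
    maxRank≡minimals : count rank-one? ≡ maxRank P
    maxRank≡minimals = trans (sym roots≡minimals)
      (HasCard-unique (HasCard-count root?) (representative , representative-inj , representative-root , surj))
    dim : Dim P (maxRank P)
    dim with subst (HasCard (λ x → rk P x ≡ 1)) maxRank≡minimals (HasCard-count rank-one?)
    ... | e , e-inj , e-rk , e-sur = e , e-inj , rk≡1⇒minimal ∘ e-rk , λ x → e-sur x ∘ minimal⇒rk≡1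

  -- The only elements covered by `v` are the two of its pair, so deciding equality is enough.
  covers? : ∀ x v → Dec (x ◁ v)
  covers? x v with rank-one? v
  ... | yes eq = no (λ xv → <-irrefl (sym eq) (◁⇒2≤rk xv))
  ... | no r≢1 with coverPair v r≢1
  ...   | a , b , _ , av , bv , all = map′ [ (λ { refl → av }) , (λ { refl → bv }) ]′ (all x) ((x ≟ a) ⊎-dec (x ≟ b))

  -- The order is not assumed decidable; a maximal z with x ⊑ z ⊏ v exists only up to double
  -- negation, which suffices here because the alternative to refute is ⊥.
  below-cover : ∀ {x v a b} → CoverPair P v a b → Dec (x ⊑ a) → Dec (x ⊑ b) → x ⊏ v → x ⊑ a ⊎ x ⊑ b
  below-cover _ (yes x⊑a) _         _ = inj₁ x⊑a
  below-cover _ (no _)    (yes x⊑b) _ = inj₂ x⊑b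
  below-cover {x} {v} (_ , _ , _ , all) (no x⋢a) (no x⋢b) x⊏v =
    ⊥-elim (climb (rk P v) x (≼-refl P x) x⊏v (m≤m+n (rk P v) _))
    where
    climb : ∀ m z → x ⊑ z → z ⊏ v → rk P v ≤ m + rk P z → ⊥
    climb zero    z x⊑z z⊏v le = <-irrefl refl (<-≤-trans (rk-strict P z⊏v) le)
    climb (suc m) z x⊑z z⊏v le with all z (z⊏v , λ z′ z⊏z′ z′⊏v →
        climb m z′ (≼-trans P x⊑z (proj₁ z⊏z′)) z′⊏v
          (≤-trans le (≤-trans (≤-reflexive (sym (+-suc m _))) (+-monoʳ-≤ m (rk-strict P z⊏z′)))))
    ... | inj₁ refl = x⋢a x⊑z
    ... | inj₂ refl = x⋢b x⊑z

  -- Being below `v` means being `v` or being below one of the two elements that it covers. The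
  -- bound `m` on the rank drives the recursion.
  ≼?-ranked : ∀ m v → rk P v ≤ m → ∀ x → Dec (x ⊑ v)
  ≼?-ranked zero    v rv≤ x = contradiction (≤-trans (rk-pos P v) rv≤) λ ()
  ≼?-ranked (suc m) v rv≤ x with rank-one? v
  ... | yes eq = map′ (λ { refl → ≼-refl P x }) (rk≡1⇒minimal eq x) (x ≟ v)
  ... | no r≢1 with coverPair v r≢1
  ...   | a , b , p@(_ , av , bv , _) with ≼?-ranked m a (lower av) x | ≼?-ranked m b (lower bv) x
    where
    lower : ∀ {c} → c ◁ v → rk P c ≤ m
    lower cv = ≤-pred (≤-trans (rk-strict P (proj₁ cv)) rv≤)
  ...     | x⊑a? | x⊑b? = map′ [ (λ { refl → ≼-refl P x }) , [ up av , up bv ]′ ]′ down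
                            ((x ≟ v) ⊎-dec (x⊑a? ⊎-dec x⊑b?))
    where
    up : ∀ {c} → c ◁ v → x ⊑ c → x ⊑ v
    up cv x⊑c = ≼-trans P x⊑c (proj₁ (proj₁ cv))
    down : x ⊑ v → x ≡ v ⊎ (x ⊑ a ⊎ x ⊑ b)
    down x⊑v with x ≟ v
    ... | yes x≡v = inj₁ x≡v
    ... | no x≢v  = inj₂ (below-cover p x⊑a? x⊑b? (x⊑v , x≢v))

  _≼?_ : ∀ x v → Dec (x ⊑ v)
  x ≼? v = ≼?-ranked (rk P v) v ≤-refl x

  -- Descend from `v` through covered elements that stay above `x`. The element passed just before
  -- reaching `x` covers it.
  upper-cover : ∀ m {x v} → rk P v ≤ m → x ⊏ v → ∃[ u ] x ◁ u
  upper-cover zero    rv≤ x⊏v = contradiction (≤-trans (rk-strict P x⊏v) rv≤) λ ()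
  upper-cover (suc m) {x} {v} rv≤ x⊏v
    with coverPair v (λ eq → <-irrefl refl (<-≤-trans (rk-strict P x⊏v) (subst (_≤ rk P x) (sym eq) (rk-pos P x))))
  ... | a , b , p@(_ , av , bv , _) = [ descend av , descend bv ]′ (below-cover p (x ≼? a) (x ≼? b) x⊏v)
    where
    descend : ∀ {c} → c ◁ v → x ⊑ c → ∃[ u ] x ◁ u
    descend {c} cv x⊑c with x ≟ c
    ... | yes refl = v , cv
    ... | no x≢c   = upper-cover m (≤-pred (≤-trans (rk-strict P (proj₁ cv)) rv≤)) (x⊑c , x≢c)

  -- Connectedness passes down the ranks

  covers-connected : ∀ {v x y} → x ◁ v → y ◁ v → Connected x y
  covers-connected {v} {x} {y} xv yv with x ≟ y
  ... | yes refl = ε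
  ... | no x≢y   = (v , CoverPair-of xv yv x≢y) ◅ ε

  -- Induction along the walk. By proximity the adjacent `u` and `t` cover a common `z`; then `u`
  -- connects `x` to `z`, and the walk continues from `z` below `t`.
  covers-of-connected : Proximity P → ∀ {u w x y} → Connected u w → x ◁ u → y ◁ w → Connected x y
  covers-of-connected prox ε xu yw = covers-connected xu yw
  covers-of-connected prox ((s , p@(u≢t , us , ts , _)) ◅ c) xu yw
    with prox _ _ u≢t (CoverPair-rk p) (◁⇒2≤rk xu) (s , us , ts)
  ... | z , zu , zt = covers-connected xu zu ◅◅ covers-of-connected prox c zt yw

  -- Induction on `m`, the distance in rank from `t`. At distance 0 both elements are `t`; otherwise
  -- both have upper covers, which are connected by induction.
  top⇒RankwiseConnected : Proximity P → ∀ t → (∀ x → x ⊑ t) → RankwiseConnected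
  top⇒RankwiseConnected prox t top x y = go (rk P t ∸ rk P x) x y (m∸n+n≡m (rk-mono (top x)))
    where
    go : ∀ m x y → m + rk P x ≡ rk P t → rk P x ≡ rk P y → Connected x y
    go zero x y eq rx≡ry with top-rank (top x) eq | top-rank (top y) (trans (sym rx≡ry) eq)
    ... | refl | refl = ε
    go (suc m) x y eq rx≡ry with above x eq | above y (trans (cong (suc m +_) (sym rx≡ry)) eq)
      where
      above : ∀ z → suc m + rk P z ≡ rk P t → ∃[ u ] z ◁ u
      above z eq = upper-cover (rk P t) ≤-refl
        (top z , λ { refl → <-irrefl refl (≤-trans (s≤s (m≤n+m (rk P z) m)) (≤-reflexive eq)) })
    ... | u , xu | w , yw = covers-of-connected prox
      (go m u w (trans (trans (cong (m +_) (rk-cover P xu)) (+-suc m _)) eq)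
                (trans (rk-cover P xu) (trans (cong suc rx≡ry) (sym (rk-cover P yw)))))
      xu yw

-- Vines and graded posets on down-sets

ideal-isVine : ∀ {Q P f} → IsIdealEmbedding Q P f → IsVine P → IsVine Q
ideal-isVine {Q} {P} {f} emb V = pairs , unique , λ i _ _ c → forest i (Cycle-push c)
  where
  open Ideal {Q} {P} emb
  open Vine P V using (forest)
  pairs : ∀ v → ¬ IsMinimal Q v → ∃₂ (CoverPair Q v)
  pairs v ¬min with proj₁ V (f v) (¬min ∘ minimal-pull)
  ... | _ , _ , p with CoverPair-down p
  ...   | a , b , _ , _ , p′ = a , b , p′
  unique : ∀ a b u w → a ≢ b → rk Q a ≡ rk Q b →
           _⋖_ Q a u → _⋖_ Q b u → _⋖_ Q a w → _⋖_ Q b w → u ≡ w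
  unique a b u w a≢b eq au bu aw bw = f-inj (proj₁ (proj₂ V) (f a) (f b) (f u) (f w) (a≢b ∘ f-inj)
    (trans (f-rk a) (trans eq (sym (f-rk b)))) (◁-push au) (◁-push bu) (◁-push aw) (◁-push bw))

module Restriction (P : GradedPoset) {D : Fin (n P) → Set} (down : ∀ {x y} → _≼_ P x y → D y → D x)
                   {k : ℕ} (card : HasCard D k) where
  open Graded P
  private
    e     = proj₁ card
    e-inj = proj₁ (proj₂ card)
    e-D   = proj₁ (proj₂ (proj₂ card))
    e-sur = proj₂ (proj₂ (proj₂ card))

  e-down : ∀ x z → z ⊑ e x → ∃[ y ] e y ≡ z
  e-down x z z⊑ = e-sur z (down z⊑ (e-D x))

  -- The rank needs no adjustment: by downward closure, covers and minimal elements inside `D` are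
  -- covers and minimal elements of `P`.
  restriction : GradedPoset
  restriction = record
    { n = k
    ; _≼_ = λ x y → e x ⊑ e y
    ; ≼-refl = ≼-refl P ∘ e
    ; ≼-antisym = λ p q → e-inj (≼-antisym P p q)
    ; ≼-trans = ≼-trans P
    ; rk = rk P ∘ e
    ; rk-pos = rk-pos P ∘ e
    ; rk-strict = λ (p , x≢y) → rk-strict P (p , x≢y ∘ e-inj)
    ; rk-cover = λ {x} {y} ((p , x≢y) , no-between) →
        rk-cover P ((p , x≢y ∘ e-inj) , λ z x⊏z z⊏y → between no-between x⊏z z⊏y)
    ; rk-min = λ x min → rk-min P (e x) (minimal min)
    }
    where
    between : ∀ {x y z} →
              (∀ t → (e x ⊑ e t × x ≢ t) → (e t ⊑ e y × t ≢ y) → ⊥) → e x ⊏ z → z ⊏ e y → ⊥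
    between {x} {y} {z} no-between (p , x≢z) (q , z≢y) with e-down y z q
    ... | t , refl = no-between t (p , x≢z ∘ cong e) (q , z≢y ∘ cong e)
    minimal : ∀ {x} → (∀ y → e y ⊑ e x → y ≡ x) → IsMinimal P (e x)
    minimal {x} min z z⊑ with e-down x z z⊑
    ... | t , refl = cong e (min t z⊑)

  embedding : IsIdealEmbedding restriction P e
  embedding = e-inj , (λ x y → id , id) , (λ x → refl) , e-down

-- Adding a maximal element

chain : ∀ {A : Set} {k} (g : Fin (suc k) → A) → (∀ t → g (inject₁ t) ≡ g (fsuc t)) →
        g fzero ≡ g (fromℕ k)
chain {k = zero}  g h = refl
chain {k = suc k} g h = trans (h fzero) (chain (g ∘ fsuc) (h ∘ fsuc))

-- Cutting a path at its step `j` leaves two arcs, and `g` is constant on each.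
chain-except : ∀ {A : Set} {k} (g : Fin (suc k) → A) (j : Fin k) →
               (∀ t → t ≢ j → g (inject₁ t) ≡ g (fsuc t)) →
               g fzero ≡ g (inject₁ j) × g (fsuc j) ≡ g (fromℕ k)
chain-except g fzero    h = refl , chain (g ∘ fsuc) (λ t → h (fsuc t) λ ())
chain-except g (fsuc j) h with chain-except (g ∘ fsuc) j (λ t t≢j → h (fsuc t) (t≢j ∘ suc-injective))
... | eq , eq′ = trans (h fzero λ ()) eq , eq′

-- The new element is `fzero`, placed above everything below `a` or `b`. The hypothesis `¬conn`
-- keeps the levels acyclic and the edges unique, while `shared` preserves proximity.
module Extension (P : GradedPoset) (V : IsVine P) (prox : Proximity P)
                 {a b : Fin (n P)} (ra≡rb : rk P a ≡ rk P b) (¬conn : ¬ Graded.Connected P a b)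
                 (shared : rk P a ≡ 1 ⊎ ∃[ c ] (_⋖_ P c a × _⋖_ P c b)) where
  open Vine P V

  _≼′_ : Fin (suc (n P)) → Fin (suc (n P)) → Set
  fzero  ≼′ fzero  = ⊤
  fzero  ≼′ fsuc _ = ⊥
  fsuc x ≼′ fzero  = x ⊑ a ⊎ x ⊑ b
  fsuc x ≼′ fsuc y = x ⊑ y

  rk′ : Fin (suc (n P)) → ℕ
  rk′ fzero    = suc (rk P a)
  rk′ (fsuc x) = rk P x

  below-rk : ∀ {x} → x ⊑ a ⊎ x ⊑ b → rk P x ≤ rk P a
  below-rk (inj₁ x⊑a) = rk-mono x⊑a
  below-rk {x} (inj₂ x⊑b) = subst (rk P x ≤_) (sym ra≡rb) (rk-mono x⊑b)

  maximal-below : ∀ {x} → x ⊑ a ⊎ x ⊑ b → (∀ y → y ≡ a ⊎ y ≡ b → x ⊏ y → ⊥) → x ≡ a ⊎ x ≡ b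
  maximal-below {x} (inj₁ x⊑a) max with x ≟ a
  ... | yes x≡a = inj₁ x≡a
  ... | no x≢a  = ⊥-elim (max a (inj₁ refl) (x⊑a , x≢a))
  maximal-below {x} (inj₂ x⊑b) max with x ≟ b
  ... | yes x≡b = inj₂ x≡b
  ... | no x≢b  = ⊥-elim (max b (inj₂ refl) (x⊑b , x≢b))

  a-or-b-below : ∀ {y} → y ≡ a ⊎ y ≡ b → y ⊑ a ⊎ y ⊑ b
  a-or-b-below (inj₁ refl) = inj₁ (≼-refl P a)
  a-or-b-below (inj₂ refl) = inj₂ (≼-refl P b)

  extension : GradedPoset
  extension = record
    { n = suc (n P)
    ; _≼_ = _≼′_
    ; ≼-refl = λ { fzero → tt ; (fsuc x) → ≼-refl P x }
    ; ≼-antisym = λ { {fzero} {fzero} _ _ → refl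
                    ; {fsuc _} {fsuc _} p q → cong fsuc (≼-antisym P p q)
                    ; {fzero} {fsuc _} () ; {fsuc _} {fzero} _ () }
    ; ≼-trans = λ {x} {y} {z} → trans′ {x} {y} {z}
    ; rk = rk′
    ; rk-pos = λ { fzero → s≤s z≤n ; (fsuc x) → rk-pos P x }
    ; rk-strict = strict
    ; rk-cover = cover
    ; rk-min = λ { fzero min → contradiction (min (fsuc a) (inj₁ (≼-refl P a))) λ ()
                 ; (fsuc x) min → rk-min P x (λ y y⊑x → suc-injective (min (fsuc y) y⊑x)) }
    }
    where
    trans′ : ∀ {x y z} → x ≼′ y → y ≼′ z → x ≼′ z
    trans′ {fzero}  {fzero}  {z}      _ q        = q
    trans′ {fsuc _} {fzero}  {fzero}  p _        = p
    trans′ {fsuc _} {fsuc _} {fzero}  p (inj₁ q) = inj₁ (≼-trans P p q)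
    trans′ {fsuc _} {fsuc _} {fzero}  p (inj₂ q) = inj₂ (≼-trans P p q)
    trans′ {fsuc _} {fsuc _} {fsuc _} p q        = ≼-trans P p q

    strict : ∀ {x y} → (x ≼′ y × x ≢ y) → rk′ x < rk′ y
    strict {fzero}  {fzero}  (_ , x≢y) = contradiction refl x≢y
    strict {fsuc _} {fzero}  (p , _)   = s≤s (below-rk p)
    strict {fsuc _} {fsuc _} (p , x≢y) = rk-strict P (p , x≢y ∘ cong fsuc)

    cover : ∀ {x y} → (x ≼′ y × x ≢ y) × (∀ z → (x ≼′ z × x ≢ z) → (z ≼′ y × z ≢ y) → ⊥) →
            rk′ y ≡ suc (rk′ x)
    cover {fzero}  {fzero}  ((_ , x≢y) , _) = contradiction refl x≢y
    cover {fsuc x} {fzero}  ((p , _) , no-between)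
      with maximal-below p (λ y y≡ (x⊑y , x≢y) →
             no-between (fsuc y) (x⊑y , x≢y ∘ suc-injective) (a-or-b-below y≡ , λ ()))
    ... | inj₁ refl = refl
    ... | inj₂ refl = cong suc ra≡rb
    cover {fsuc x} {fsuc y} ((p , x≢y) , no-between) =
      rk-cover P ((p , x≢y ∘ cong fsuc) , λ z (x⊑z , x≢z) (z⊑y , z≢y) →
        no-between (fsuc z) (x⊑z , x≢z ∘ suc-injective) (z⊑y , z≢y ∘ suc-injective))

  embedding : IsIdealEmbedding P extension fsuc
  embedding = suc-injective , (λ x y → id , id) , (λ x → refl) , λ { x (fsuc z) _ → z , refl }

  open Ideal {P} {extension} embedding
  private module E = Graded extension

  top-CoverPair : CoverPair extension fzero (fsuc a) (fsuc b)
  top-CoverPair = (λ { refl → ¬conn ε }) , covered (inj₁ refl) , covered (inj₂ refl) , all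
    where
    covered : ∀ {y} → y ≡ a ⊎ y ≡ b → fsuc y E.◁ fzero
    covered {y} y≡ = (a-or-b-below y≡ , λ ()) , λ
      { fzero    _         (_ , z≢z) → z≢z refl
      ; (fsuc z) (y⊑z , y≢z) (z⊑ , _)  →
          <-irrefl refl (<-≤-trans (rk-strict P (y⊑z , y≢z ∘ cong fsuc))
                                   (≤-trans (below-rk z⊑) (≤-reflexive (rank y≡)))) }
      where
      rank : y ≡ a ⊎ y ≡ b → rk P a ≡ rk P y
      rank (inj₁ refl) = refl
      rank (inj₂ refl) = ra≡rb
    all : ∀ c → c E.◁ fzero → c ≡ fsuc a ⊎ c ≡ fsuc b
    all fzero    ((_ , c≢c) , _) = contradiction refl c≢c
    all (fsuc x) ((p , _) , no-between)
      with maximal-below p (λ y y≡ (x⊑y , x≢y) →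
             no-between (fsuc y) (x⊑y , x≢y ∘ suc-injective) (a-or-b-below y≡ , λ ()))
    ... | inj₁ refl = inj₁ refl
    ... | inj₂ refl = inj₂ refl

  pairs : ∀ v → ¬ IsMinimal extension v → ∃₂ (CoverPair extension v)
  pairs fzero    _    = fsuc a , fsuc b , top-CoverPair
  pairs (fsuc v) ¬min with coverPair v (¬min ∘ E.rk≡1⇒minimal)
  ... | x , y , p = fsuc x , fsuc y , CoverPair-push p

  -- The two elements must be `a` and `b`, so `w` would connect them in `P`.
  top-alone : ∀ {p q w} → p ≢ q → p E.◁ fzero → q E.◁ fzero → p E.◁ fsuc w → q E.◁ fsuc w → ⊥
  top-alone p≢q p0 q0 pw qw with E.CoverPair-match top-CoverPair p0 q0 p≢q
  ... | inj₁ (refl , refl) = ¬conn (covers-connected (◁-pull pw) (◁-pull qw))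
  ... | inj₂ (refl , refl) = ¬conn (covers-connected (◁-pull qw) (◁-pull pw))

  unique : ∀ p q u w → p ≢ q → rk′ p ≡ rk′ q →
           p E.◁ u → q E.◁ u → p E.◁ w → q E.◁ w → u ≡ w
  unique p q fzero    fzero    _   _  _  _  _  _  = refl
  unique p q fzero    (fsuc _) p≢q _  pu qu pw qw = ⊥-elim (top-alone p≢q pu qu pw qw)
  unique p q (fsuc _) fzero    p≢q _  pu qu pw qw = ⊥-elim (top-alone p≢q pw qw pu qu)
  unique p q (fsuc u) (fsuc w) p≢q eq pu qu pw qw with ◁-down pu | ◁-down qu
  ... | p′ , refl , p′u | q′ , refl , q′u =
    cong fsuc (proj₁ (proj₂ V) p′ q′ u w (p≢q ∘ cong fsuc) eq p′u q′u (◁-pull pw) (◁-pull qw))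

  -- The new edge joins two components of P, so rep changes along it and along
  -- no other edge; going round a cycle through it, rep would change exactly once.
  colour : Fin (suc (n P)) → X
  colour fzero    = a
  colour (fsuc x) = rep x

  colour-old : ∀ {v x y} → v ≢ fzero → CoverPair extension v x y → colour x ≡ colour y
  colour-old {fzero}  v≢0 _ = contradiction refl v≢0
  colour-old {fsuc v} _   p with CoverPair-down p
  ... | _ , _ , refl , refl , p′ = rep-edge v p′

  colour-new : ∀ {x y} → CoverPair extension fzero x y → colour x ≢ colour y
  colour-new p eq with E.CoverPair-match top-CoverPair (proj₁ (proj₂ p)) (proj₁ (proj₂ (proj₂ p))) (proj₁ p)
  ... | inj₁ (refl , refl) = ¬conn (rep-≡⇒Joined eq)
  ... | inj₂ (refl , refl) = ¬conn (rep-≡⇒Joined (sym eq))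

  pair-of : ∀ {i v x y} → FEdge extension i v x y → CoverPair extension v x y
  pair-of = proj₂ ∘ proj₂ ∘ proj₂

  acyclic : ∀ i → IsForest extension i
  acyclic i c = go (eLast ≟ fzero) (any? (λ j → es j ≟ fzero))
    where
    open Cycle c
    old : ∀ v → v ≢ fzero → ∃[ v′ ] fsuc v′ ≡ v
    old fzero    v≢0 = contradiction refl v≢0
    old (fsuc v) _   = v , refl
    go : Dec (eLast ≡ fzero) → Dec (∃[ j ] es j ≡ fzero) → ⊥
    go (yes refl) _ =
      colour-new (pair-of eLast-edge)
        (sym (chain (colour ∘ xs) (λ t → colour-old (eLast-new t) (pair-of (es-edge t)))))
    -- Both arcs left by edge `j`, and the closing edge between them, preserve the colour, so the
    -- ends of the new edge would agree.
    go (no last≢0) (yes (j , ej≡0))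
      with chain-except (colour ∘ xs) j (λ t t≢j →
             colour-old (λ et≡0 → t≢j (es-inj (trans et≡0 (sym ej≡0)))) (pair-of (es-edge t)))
    ... | eq , eq′ = colour-new (subst (λ v → CoverPair extension v _ _) ej≡0 (pair-of (es-edge j)))
      (trans (sym eq) (trans (sym (colour-old last≢0 (pair-of eLast-edge))) (sym eq′)))
    -- A cycle that avoids the new edge lies entirely in `P`.
    go (no last≢0) (no none) =
      forest i (Cycle-pull c (λ j → old (es j) (λ eq → none (j , eq))) (old eLast last≢0))

  extension-isVine : IsVine extension
  extension-isVine = pairs , unique , λ i _ _ → acyclic i

  common-lower : 2 ≤ rk P a → ∃[ c ] (c ◁ a × c ◁ b)
  common-lower 2≤ra = [ (λ ra≡1 → contradiction (subst (2 ≤_) ra≡1 2≤ra) (<-irrefl refl)) , id ]′ shared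

  extension-proximity : Proximity extension
  extension-proximity p q p≢q eq 2≤rp (fzero , pu , qu) with E.CoverPair-match top-CoverPair pu qu p≢q
  ... | inj₁ (refl , refl) with common-lower 2≤rp
  ...   | c , ca , cb = fsuc c , ◁-push ca , ◁-push cb
  extension-proximity p q p≢q eq 2≤rp (fzero , pu , qu)
      | inj₂ (refl , refl) with common-lower (subst (2 ≤_) eq 2≤rp)
  ...   | c , ca , cb = fsuc c , ◁-push cb , ◁-push ca
  extension-proximity p q p≢q eq 2≤rp (fsuc u , pu , qu) with ◁-down pu | ◁-down qu
  ... | p′ , refl , p′u | q′ , refl , q′u with prox p′ q′ (p≢q ∘ cong fsuc) eq 2≤rp (u , p′u , q′u)
  ...   | c , cp , cq = fsuc c , ◁-push cp , ◁-push cq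

  -- The new element has rank at least 2. Hence the size bound stays fixed while the poset grows.
  extension-minimals : count (Vine.rank-one? extension extension-isVine) ≡ count rank-one?
  extension-minimals = cong (_+ count rank-one?)
    (indicator-no (suc (rk P a) ≟ℕ 1) (λ eq → <-irrefl (sym eq) (s≤s (rk-pos P a))))

-- Extending a proximal vine until it is connected

module Gaps (P : GradedPoset) (V : IsVine P) where
  open Vine P V

  -- Exactly the pairs to which `Extension` applies, stated through `rep` so that the search is
  -- decidable.
  Gap : X → X → Set
  Gap a b = rk P a ≡ rk P b × rep a ≢ rep b × (rk P a ≡ 1 ⊎ ∃[ c ] (c ◁ a × c ◁ b))

  gap? : Dec (∃₂ Gap)
  gap? = any? λ a → any? λ b → (rk P a ≟ℕ rk P b) ×-dec ¬? (rep a ≟ rep b) ×-dec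
           (rank-one? a ⊎-dec any? (λ c → covers? c a ×-dec covers? c b))

  no-gap⇒RankwiseConnected : ¬ ∃₂ Gap → RankwiseConnected
  no-gap⇒RankwiseConnected no-gap x y rx≡ry = rep-≡⇒Joined
    (same-rep (pred (rk P x)) x y (sym (suc-pred-pos (rk-pos P x))) rx≡ry)
    where
    merged : ∀ a b → rk P a ≡ rk P b → rk P a ≡ 1 ⊎ ∃[ c ] (c ◁ a × c ◁ b) → rep a ≡ rep b
    merged a b eq s with rep a ≟ rep b
    ... | yes α≡β = α≡β
    ... | no α≢β  = contradiction (a , b , eq , α≢β , s) no-gap

    merged-above : ∀ {c x y} → c ◁ x → c ◁ y → rep x ≡ rep y
    merged-above {c} {x} {y} cx cy =
      merged x y (trans (rk-cover P cx) (sym (rk-cover P cy))) (inj₂ (c , cx , cy))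

    lift : ∀ {a b x y} → Connected a b → a ◁ x → b ◁ y → rep x ≡ rep y
    lift ε                           ax by = merged-above ax by
    -- The edge `v` lies on the level of `x` and covers `a` as `x` does, so without a gap both share
    -- a component. The walk goes on from `c` with `v` in place of `x`.
    lift ((v , _ , av , cv , _) ◅ s) ax by = trans (merged-above ax av) (lift s cv by)

    -- Induction on the rank: elements covered by `x` and `y` are connected one level lower, and
    -- `lift` turns a walk between them into a connection of `x` and `y`.
    same-rep : ∀ m x y → rk P x ≡ suc m → rk P x ≡ rk P y → rep x ≡ rep y
    same-rep zero    x y rx rx≡ry = merged x y rx≡ry (inj₁ rx)
    same-rep (suc m) x y rx rx≡ry with lower x rx | lower y (trans (sym rx≡ry) rx)
      where
      lower : ∀ z → rk P z ≡ suc (suc m) → ∃[ c ] (rk P c ≡ suc m × c ◁ z)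
      lower z rz with coverPair z (λ rz≡1 → contradiction (trans (sym rz) rz≡1) λ ())
      ... | c , _ , _ , cz , _ = c , ℕ-suc-injective (trans (sym (rk-cover P cz)) rz) , cz
    ... | a , ra , ax | b , rb , by =
      lift (rep-≡⇒Joined (same-rep m a b ra (trans ra (sym rb)))) ax by

-- The fuel bounds the number of elements that can still be added before the size reaches the square
-- of the number of minimal elements.
proximity⇒mvine-fuelled : ∀ fuel P (V : IsVine P) → Proximity P → let open Vine P V in
                          count rank-one? * count rank-one? ≤ fuel + n P → IsMVine P
proximity⇒mvine-fuelled fuel P V prox bound with Gaps.gap? P V
... | no no-gap = P , Vine.isRVine P V prox (Gaps.no-gap⇒RankwiseConnected P V no-gap) ,
                  id , id , (λ x y → id , id) , (λ _ → refl) , λ x z _ → z , refl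
... | yes (a , b , ra≡rb , α≢β , shared) = extend fuel bound
  where
  open Vine P V using (rank-one?; Joined⇒rep-≡)
  open Extension P V prox ra≡rb (α≢β ∘ Joined⇒rep-≡) shared
  extend : ∀ fuel → count rank-one? * count rank-one? ≤ fuel + n P → IsMVine P
  -- Here `P` already has the largest size allowed, and the extension would exceed it.
  extend zero bound = contradiction
    (subst (λ d → suc (n P) ≤ d * d) extension-minimals (Vine.size-bound extension extension-isVine))
    (λ too-many → <-irrefl refl (≤-trans too-many bound))
  extend (suc fuel) bound
    with proximity⇒mvine-fuelled fuel extension extension-isVine extension-proximity
           (subst (_≤ fuel + suc (n P)) (sym (cong₂ _*_ extension-minimals extension-minimals))
             (≤-trans bound (≤-reflexive (sym (+-suc fuel (n P))))))
  ... | R , isR , f , emb = R , isR , f ∘ fsuc , IsIdealEmbedding-trans {P} {extension} {R} embedding emb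

-- The four implications

mvine⇒proximity : ∀ P → IsMVine P → Proximity P
mvine⇒proximity P (R , (_ , _ , _ , prox) , f , emb) = Ideal.proximity {P} {R} emb prox

proximity⇒mvine : ∀ P → IsVine P → Proximity P → IsMVine P
proximity⇒mvine P V prox = proximity⇒mvine-fuelled (d * d) P V prox (m≤m+n (d * d) (n P))
  where d = count (Vine.rank-one? P V)

-- Decidability of the order allows the ideal below `v` to be enumerated. It inherits the vine
-- conditions and proximity, and its greatest element `t` makes every level connected.
proximity⇒lrvine : ∀ P → IsVine P → Proximity P → IsLRVine P
proximity⇒lrvine P V prox v =
  restriction , e , embedding , e-sur , e-below ,
  Vine.isRVine restriction V′ prox′
    (Vine.top⇒RankwiseConnected restriction V′ prox′ t (λ x → subst (e x ⊑_) (sym et≡v) (e-below x)))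
  where
  open Vine P V
  card = HasCard-count (_≼? v)
  e = proj₁ card
  e-below = proj₁ (proj₂ (proj₂ card))
  e-sur = proj₂ (proj₂ (proj₂ card))
  open Restriction P (≼-trans P) card
  V′ = ideal-isVine {restriction} {P} embedding V
  prox′ = Ideal.proximity {restriction} {P} embedding prox
  t = proj₁ (e-sur v (≼-refl P v))
  et≡v = proj₂ (e-sur v (≼-refl P v))

-- The ideal below the common cover `v` contains `a`, `b` and `v`, so its own proximity provides the
-- common element.
lrvine⇒proximity : ∀ P → IsLRVine P → Proximity P
lrvine⇒proximity P lr a b a≢b ra≡rb 2≤ra (v , av , bv) with lr v
... | Q , f , emb , onto , _ , _ , _ , _ , prox
  with onto a (proj₁ (proj₁ av)) | onto b (proj₁ (proj₁ bv)) | onto v (≼-refl P v)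
... | a′ , refl | b′ , refl | v′ , refl
  with prox a′ b′ (a≢b ∘ cong f) (trans (sym (f-rk a′)) (trans ra≡rb (f-rk b′)))
            (subst (2 ≤_) (f-rk a′) 2≤ra) (v′ , ◁-pull av , ◁-pull bv)
  where open Ideal {Q} {P} emb
... | c , ca , cb = f c , ◁-push ca , ◁-push cb
  where open Ideal {Q} {P} emb

theorem6p13 : (P : GradedPoset) → IsVine P →
    (IsMVine P ⇔ Proximity P) × (Proximity P ⇔ IsLRVine P)
theorem6p13 P V =
  mk⇔ (mvine⇒proximity P) (proximity⇒mvine P V) , mk⇔ (proximity⇒lrvine P V) (lrvine⇒proximity P)
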